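{- There exists a string family on which $\ell_m = \Omega(\ell\log n/\log\log n)$, where $n$ is the length of the string.
   Context: A string family is an infinite set of finite strings of unbounded length; asymptotic notation on a family refers to strings $w$ of the family with $n=|w|\to\infty$ (with constants uniform over the family). $w[i:j]$ denotes the substring of $w$ from position $i$ to position $j$ (positions start at 1). L-systems: an L-system is a tuple $(\Sigma,\varphi,\tau,s,d,n)$, where $\Sigma$ is a finite alphabet, $\varphi:\Sigma^*\to\Sigma^*$ is a non-erasing monoid endomorphism (each rule $a\to\varphi(a)$, $a\in\Sigma$, has $|\varphi(a)|\ge 1$), $\tau:\Sigma^*\to\Sigma^*$ is a coding (a morphism with $|\tau(a)|=1$ for all $a\in\Sigma$), $s\in\Sigma^+$ is the axiom, and $d\ge 0$, $n\ge 1$ are integers. It generates the unique string $\tau(\varphi^d(s))[1:n]$ of length $n$. It is always assumed that $d=n^{O(1)}$ and $|\Sigma|=n^{O(1)}$ (each value fits in an $O(\log n)$-bit word). The size of the L-system is $\sum_{a\in\Sigma}|\varphi(a)|+|s|+|\Sigma|+2$. The measure $\ell(w)$ is the size of the smallest L-system generating $w$. An L-system is prolongable if there is a symbol $a$ such that $s=a$ and $\varphi(a)=ax$ with $x\neq\varepsilon$ (the empty string). $\ell_m(w)$ is the size of the smallest prolongable L-system generating $w$. -}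

module Defs where

open import Data.Fin.Base using (Fin)
open import Data.List.Base using (List; []; concatMap; length; map; take; allFin)
open import Data.List.NonEmpty as List⁺ using (List⁺; _∷_; toList)
open import Data.Nat.Base using (ℕ; _+_; _^_; _≤_)
open import Data.Nat.ListAction using (sum)
open import Data.Product using (Σ-syntax; ∃-syntax; _×_)
open import Function.Base using (_∘_)
open import Function.Bundles using (_↣_; Injection)
import Function.Endo.Propositional as Endo
open import Level using (0ℓ)
open import Relation.Binary.PropositionalEquality using (_≡_; _≢_)
open import Relation.Unary using (Pred; _∈_)

-- All symbols come from a fixed countable supply, so that an L-system may use
-- symbols that do not occur in the string it generates.
Symbol : Set
Symbol = ℕ

String : Set
String = List Symbol

-- Unboundedness of the lengths already makes the set infinite.
IsStringFamily : Pred String 0ℓ → Set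
IsStringFamily F = ∀ m → ∃[ w ] (w ∈ F × m ≤ length w)

-- The alphabet Σ is the image of `symbol`: a set of σ distinct symbols.
record LSystem : Set where
  field
    σ      : ℕ
    symbol : Fin σ ↣ Symbol
    φ      : Fin σ → List⁺ (Fin σ)
    τ      : Fin σ → Fin σ
    s      : List⁺ (Fin σ)
    d      : ℕ
    n      : ℕ
    1≤n    : 1 ≤ n

  φ* : List (Fin σ) → List (Fin σ)
  φ* = concatMap (toList ∘ φ)

  φᵈ[s] : List (Fin σ)
  φᵈ[s] = (φ* ↑ d) (toList s)
    where open Endo (List (Fin σ)) using () renaming (_^_ to _↑_)

  output : String
  output = map (Injection.to symbol) (take n (map τ φᵈ[s]))

  size : ℕ
  size = sum (map (List⁺.length ∘ φ) (allFin σ)) + List⁺.length s + σ + 2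

open LSystem

-- `take` truncates silently, hence the separate condition on the length.
Generates : LSystem → String → Set
Generates L w = output L ≡ w × length w ≡ n L

Prolongable : Pred LSystem 0ℓ
Prolongable L =
  ∃[ a ] ∃[ x ] (s L ≡ a ∷ [] × φ L a ≡ a ∷ x × x ≢ [])

-- d = n^O(1) and |Σ| = n^O(1), with the exponent made explicit.  A constant
-- factor is absorbed by a larger exponent as soon as n ≥ 2.
PolyBounded : ℕ → Pred LSystem 0ℓ
PolyBounded k L = d L ≤ n L ^ k × σ L ≤ n L ^ k

IsLeast : Pred ℕ 0ℓ → Pred ℕ 0ℓ
IsLeast P m = P m × (∀ j → P j → m ≤ j)

-- The measures are given by their graphs: Isℓ k w m means ℓ(w) = m, where k is
-- the exponent of PolyBounded.  For k ≥ 1 every nonempty string is generated by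
-- some prolongable system within the bounds (one symbol per position, the first
-- rewriting to all of them, or to two copies of itself if it is the only one),
-- so classically both minima exist.
Isℓ : ℕ → String → Pred ℕ 0ℓ
Isℓ k w = IsLeast λ m →
  Σ[ L ∈ LSystem ] (PolyBounded k L × Generates L w × size L ≡ m)

Isℓₘ : ℕ → String → Pred ℕ 0ℓ
Isℓₘ k w = IsLeast λ m →
  Σ[ L ∈ LSystem ] (Prolongable L × PolyBounded k L × Generates L w × size L ≡ m)

{-# OPTIONS --safe #-}

-- The family is a^p b.  It is generated by the system a → a, b → ab of constant
-- size, started from b and iterated exactly p times.  A prolongable system of
-- size m cannot exploit the number of iterations: every letter that it ever
-- produces occurs already after at most σ ≤ m iterations (cut the loops out of
-- its chain of ancestors), in a word which is a prefix of all later ones and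
-- whose length is at most m ^ m.  Since b is first seen at position n,
-- this gives n ≤ m ^ m, whence log n = O(m log log n).
module Submission where

open import Data.Fin.Base using (Fin; toℕ) renaming (zero to fzero; suc to fsuc)
open import Data.Fin.Properties using (toℕ-injective; toℕ≤pred[n]; pigeonhole)
open import Data.List.Base
  using (List; []; _∷_; [_]; _++_; length; map; take; replicate; concatMap; allFin)
open import Data.List.Membership.Propositional using (lose; find)
  renaming (_∈_ to _∈ˡ_)
open import Data.List.Membership.Propositional.Properties
  using (∈-concatMap⁺; ∈-concatMap⁻; ∈-map⁺; ∈-map⁻; ∈-++⁺ʳ; ∈-allFin)
open import Data.List.NonEmpty as List⁺ using (List⁺; _∷_; toList)
open import Data.List.Properties
  using (∷-injectiveʳ; concatMap-++; length-++; length-map; map-++; map-∘;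
         map-replicate; map-id; take-all; take-map)
open import Data.List.Relation.Unary.Any using (here; there)
open import Data.Nat.Base
  using (ℕ; zero; suc; _+_; _*_; _∸_; _^_; _≤_; _<_; z≤n; s≤s; >-nonZero)
open import Data.Nat.Induction using (<-rec)
open import Data.Nat.ListAction using (sum)
open import Data.Nat.Logarithm using (⌊log₂_⌋; ⌊log₂⌋-mono-≤; ⌊log₂[2^n]⌋≡n)
open import Data.Nat.Properties
open import Data.Nat.Tactic.RingSolver using (solve-∀)
open import Data.Product using (Σ-syntax; ∃-syntax; _×_; _,_; proj₁; proj₂)
open import Data.Sum using (inj₁; inj₂; [_,_]′)
open import Function.Base using (_∘_; id)
open import Function.Bundles using (Injection; mk↣)
import Function.Endo.Propositional as Endo
open import Level using (0ℓ)
open import Relation.Binary.PropositionalEquality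
  using (_≡_; refl; sym; trans; cong; cong₂; subst; module ≡-Reasoning)
open import Relation.Unary using (Pred; _∈_)
open import Defs

-- Iterated morphisms on words.

iterate : {A : Set} → (A → A) → ℕ → A → A
iterate {A = A} f n = f ↑ n
  where open Endo A using () renaming (_^_ to _↑_)

iterate-+ : ∀ {A : Set} (f : A → A) m n x → iterate f (m + n) x ≡ iterate f m (iterate f n x)
iterate-+ {A = A} f m n x = cong (λ g → g x) (Endo.^-homo A f m n)

module Morphism {A : Set} (f : A → List A) where

  -- For `f = toList ∘ φ` this unfolds to the iteration behind `φᵈ[s]`, so facts about `word` apply
  -- to L-systems without conversion.
  word : ℕ → List A → List A
  word = iterate (concatMap f)

  ∈-word⁻ : ∀ n {x ys} → x ∈ˡ word n ys → ∃[ y ] (y ∈ˡ ys × x ∈ˡ word n [ y ])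
  ∈-word⁻ zero    x∈ = _ , x∈ , here refl
  ∈-word⁻ (suc n) x∈ with find (∈-concatMap⁻ f x∈)
  ... | z , z∈ , x∈fz with ∈-word⁻ n z∈
  ... | y , y∈ , z∈′ = y , y∈ , ∈-concatMap⁺ f (lose z∈′ x∈fz)

  ∈-word⁺ : ∀ n {x y ys} → y ∈ˡ ys → x ∈ˡ word n [ y ] → x ∈ˡ word n ys
  ∈-word⁺ zero    y∈ (here refl) = y∈
  ∈-word⁺ (suc n) y∈ x∈ with find (∈-concatMap⁻ f x∈)
  ... | z , z∈ , x∈fz = ∈-concatMap⁺ f (lose (∈-word⁺ n y∈ z∈) x∈fz)

  length-concatMap-≤ : ∀ {m} → (∀ a → length (f a) ≤ m) →
                       ∀ xs → length (concatMap f xs) ≤ m * length xs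
  length-concatMap-≤ {m} f≤m []       = z≤n
  length-concatMap-≤ {m} f≤m (x ∷ xs) = begin
    length (f x ++ concatMap f xs)         ≡⟨ length-++ (f x) ⟩
    length (f x) + length (concatMap f xs) ≤⟨ +-mono-≤ (f≤m x) (length-concatMap-≤ f≤m xs) ⟩
    m + m * length xs                      ≡⟨ *-suc m (length xs) ⟨
    m * suc (length xs)                    ∎
    where open ≤-Reasoning

  length-word-≤ : ∀ {m} → (∀ a → length (f a) ≤ m) →
                  ∀ n a → length (word n [ a ]) ≤ m ^ n
  length-word-≤ f≤m zero    a = s≤s z≤n
  length-word-≤ {m} f≤m (suc n) a =
    ≤-trans (length-concatMap-≤ f≤m (word n [ a ]))
            (*-monoʳ-≤ m (length-word-≤ f≤m n a))

  word-++ : ∀ n xs ys → word n (xs ++ ys) ≡ word n xs ++ word n ys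
  word-++ zero    xs ys = refl
  word-++ (suc n) xs ys =
    trans (cong (concatMap f) (word-++ n xs ys)) (concatMap-++ f (word n xs) (word n ys))

  word-prefix : ∀ {a x} → f a ≡ a ∷ x →
                ∀ n → ∃[ ys ] word n [ a ] ≡ a ∷ ys
  word-prefix fa≡ax zero = [] , refl
  word-prefix {a} fa≡ax (suc n) with word-prefix fa≡ax n
  ... | ys , eq = _ , trans (cong (concatMap f) eq) (cong (_++ concatMap f ys) fa≡ax)

  -- The first `n ∸ m` iterations give a word that still begins with `a`; the remaining `m`
  -- iterations turn that `a` into `word m [ a ]`, at the front.
  word-mono : ∀ {a x} → f a ≡ a ∷ x →
              ∀ {m n} → m ≤ n → ∃[ ys ] word n [ a ] ≡ word m [ a ] ++ ys
  word-mono {a} fa≡ax {m} {n} m≤n with word-prefix fa≡ax (n ∸ m)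
  ... | ys , eq = word m ys , (begin
    word n [ a ]                ≡⟨ cong (λ k → word k [ a ]) (m+[n∸m]≡n m≤n) ⟨
    word (m + (n ∸ m)) [ a ]    ≡⟨ iterate-+ (concatMap f) m (n ∸ m) [ a ] ⟩
    word m (word (n ∸ m) [ a ]) ≡⟨ cong (word m) eq ⟩
    word m (a ∷ ys)             ≡⟨ word-++ m [ a ] ys ⟩
    word m [ a ] ++ word m ys   ∎)
    where open ≡-Reasoning

  ancestor : ∀ {x ys n i} → i ≤ n → x ∈ˡ word n ys →
             ∃[ y ] (y ∈ˡ word i ys × x ∈ˡ word (n ∸ i) [ y ])
  ancestor {x} {ys} {n} {i} i≤n x∈ = ∈-word⁻ (n ∸ i) (subst (x ∈ˡ_) eq x∈)
    where
    eq : word n ys ≡ word (n ∸ i) (word i ys)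
    eq = trans (cong (λ k → word k ys) (sym (m∸n+n≡m i≤n)))
               (iterate-+ (concatMap f) (n ∸ i) i ys)

-- Early occurrence of letters over a finite alphabet.

module _ {σ : ℕ} (f : Fin σ → List (Fin σ)) where

  open Morphism f

  -- The ancestors of `x` in generations 0 to `σ` are `σ + 1` letters from an alphabet of size `σ`,
  -- so two of them coincide, and the generations between these two can be cut out.
  shorten : ∀ {n x ys} → σ ≤ n → x ∈ˡ word n ys →
            ∃[ n′ ] (n′ < n × x ∈ˡ word n′ ys)
  shorten {n} {x} {ys} σ≤n x∈ = excise (pigeonhole (n<1+n σ) (proj₁ ∘ chain))
    where
    chain : (i : Fin (suc σ)) →
            ∃[ y ] (y ∈ˡ word (toℕ i) ys × x ∈ˡ word (n ∸ toℕ i) [ y ])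
    chain i = ancestor (≤-trans (toℕ≤pred[n] i) σ≤n) x∈

    excise : ∃[ i ] ∃[ j ] (toℕ i < toℕ j × proj₁ (chain i) ≡ proj₁ (chain j)) →
             ∃[ n′ ] (n′ < n × x ∈ˡ word n′ ys)
    -- The repeated letter is reached after `i` iterations, and `n ∸ j` further ones lead from it to
    -- `x`.
    excise (i , j , i<j , yᵢ≡yⱼ) = n ∸ toℕ j + toℕ i , n′<n , x∈′
      where
      j≤n : toℕ j ≤ n
      j≤n = ≤-trans (toℕ≤pred[n] j) σ≤n

      n′<n : n ∸ toℕ j + toℕ i < n
      n′<n = subst (n ∸ toℕ j + toℕ i <_) (m∸n+n≡m j≤n) (+-monoʳ-< (n ∸ toℕ j) i<j)

      x∈′ : x ∈ˡ word (n ∸ toℕ j + toℕ i) ys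
      x∈′ = subst (x ∈ˡ_) (sym (iterate-+ (concatMap f) (n ∸ toℕ j) (toℕ i) ys))
        (∈-word⁺ (n ∸ toℕ j)
          (subst (_∈ˡ word (toℕ i) ys) yᵢ≡yⱼ (proj₁ (proj₂ (chain i))))
          (proj₂ (proj₂ (chain j))))

  -- Repeated shortening stops only at or below `σ`. The bound `n′ ≤ n` is recorded because
  -- `word-mono` asks for it.
  occurs-early : ∀ n {x ys} → x ∈ˡ word n ys →
                 ∃[ n′ ] (n′ ≤ n × n′ ≤ σ × x ∈ˡ word n′ ys)
  occurs-early n {x} {ys} = <-rec Early (λ _ → early) n
    where
    Early : Pred ℕ 0ℓ
    Early n = x ∈ˡ word n ys → ∃[ n′ ] (n′ ≤ n × n′ ≤ σ × x ∈ˡ word n′ ys)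

    early : ∀ {n} → (∀ {k} → k < n → Early k) → Early n
    early {n} rec x∈ with ≤-total n σ
    ... | inj₁ n≤σ = n , ≤-refl , n≤σ , x∈
    ... | inj₂ σ≤n with shorten σ≤n x∈
    ... | k , k<n , x∈ₖ with rec k<n x∈ₖ
    ... | n′ , n′≤k , n′≤σ , x∈ₙ′ = n′ , ≤-trans n′≤k (<⇒≤ k<n) , n′≤σ , x∈ₙ′

-- The strings a^p b, with 0 for a and 1 for b, and prolongable systems.

aᵖb : ℕ → String
aᵖb p = replicate p 0 ++ [ 1 ]

length-aᵖb : ∀ p → length (aᵖb p) ≡ suc p
length-aᵖb zero    = refl
length-aᵖb (suc p) = cong suc (length-aᵖb p)

∈-take⁻ : ∀ {A : Set} n {x : A} xs → x ∈ˡ take n xs → x ∈ˡ xs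
∈-take⁻ (suc n) (x ∷ xs) (here eq)  = here eq
∈-take⁻ (suc n) (x ∷ xs) (there x∈) = there (∈-take⁻ n xs x∈)

-- The first `p` symbols are all 0, so a prefix that contains 1 must extend past them.
aᵖb-prefix : ∀ p {xs ys} → take (suc p) (xs ++ ys) ≡ aᵖb p →
             1 ∈ˡ xs → suc p ≤ length xs
aᵖb-prefix p       {[]}     eq ()
aᵖb-prefix zero    {x ∷ xs} eq _ = s≤s z≤n
aᵖb-prefix (suc p) {x ∷ xs} eq (here refl) with () ← eq
aᵖb-prefix (suc p) {x ∷ xs} eq (there 1∈) = s≤s (aᵖb-prefix p (∷-injectiveʳ eq) 1∈)

∈⇒≤sum : ∀ {m ms} → m ∈ˡ ms → m ≤ sum ms
∈⇒≤sum {m} (here refl) = m≤m+n m _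
∈⇒≤sum (there {x = x} m∈) = ≤-trans (∈⇒≤sum m∈) (m≤n+m _ x)

length-φ≤size : ∀ L a → List⁺.length (LSystem.φ L a) ≤ LSystem.size L
length-φ≤size L a = begin
  List⁺.length (φ a) ≤⟨ ∈⇒≤sum (∈-map⁺ (List⁺.length ∘ φ) (∈-allFin a)) ⟩
  Σφ                 ≤⟨ m≤m+n Σφ _ ⟩
  Σφ + _             ≤⟨ m≤m+n (Σφ + _) σ ⟩
  Σφ + _ + σ         ≤⟨ m≤m+n (Σφ + _ + σ) 2 ⟩
  size               ∎
  where
  open LSystem L
  open ≤-Reasoning
  Σφ = sum (map (List⁺.length ∘ φ) (allFin σ))

σ≤size : ∀ L → LSystem.σ L ≤ LSystem.size L
σ≤size L = ≤-trans (m≤n+m σ _) (m≤m+n _ 2)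
  where open LSystem L

2≤size : ∀ L → 2 ≤ LSystem.size L
2≤size L = m≤n+m 2 _

-- The symbol 1 comes from a letter `z` that occurs already in `u = word d′ [ a ]`. As `u` is a
-- prefix of `word d [ a ]`, its coded image has to reach position `p + 1`, while each iteration
-- lengthens a word at most by the factor `size`.
prolongable-lower-bound : ∀ p L → Prolongable L → Generates L (aᵖb p) →
                          suc p ≤ LSystem.size L ^ LSystem.size L
prolongable-lower-bound p L (a , x , s≡a , φa≡ax , _) (output≡w , |w|≡n) =
  let open ≤-Reasoning
      z , z∈ , 1≡hz      = ∈-map⁻ h 1∈map
      d′ , d′≤d , d′≤σ , z∈′ = occurs-early (toList ∘ φ) d z∈
      v , word≡          = word-mono (cong toList φa≡ax) d′≤d
      u                  = word d′ [ a ]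
  in begin
    suc p             ≤⟨ aᵖb-prefix p {map h u} {map h v}
                           (trans (cong (take (suc p))
                                    (trans (sym (map-++ h u v)) (cong (map h) (sym word≡))))
                                  take≡w)
                           (subst (_∈ˡ map h u) (sym 1≡hz) (∈-map⁺ h z∈′)) ⟩
    length (map h u)  ≡⟨ length-map h u ⟩
    length u          ≤⟨ length-word-≤ (length-φ≤size L) d′ a ⟩
    size ^ d′         ≤⟨ ^-monoʳ-≤ size {{>-nonZero (≤-trans (s≤s z≤n) (2≤size L))}}
                           (≤-trans d′≤σ (σ≤size L)) ⟩
    size ^ size       ∎
  where
  open LSystem L
  open Morphism (toList ∘ φ)

  h : Fin σ → Symbol
  h = Injection.to symbol ∘ τ

  n≡1+p : n ≡ suc p
  n≡1+p = trans (sym |w|≡n) (length-aᵖb p)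

  -- `output` truncates between `τ` and `symbol`; truncation is moved outside so that both codings
  -- merge into `h`.
  take≡w : take (suc p) (map h (word d [ a ])) ≡ aᵖb p
  take≡w = begin
    take (suc p) (map h (word d [ a ]))    ≡⟨ cong₂ (λ k t → take k (map h (word d (toList t))))
                                                    n≡1+p s≡a ⟨
    take n (map h φᵈ[s])                   ≡⟨ cong (take n) (map-∘ φᵈ[s]) ⟩
    take n (map (Injection.to symbol) (map τ φᵈ[s])) ≡⟨ take-map n (map τ φᵈ[s]) ⟩
    output                                 ≡⟨ output≡w ⟩
    aᵖb p                                  ∎
    where open ≡-Reasoning

  1∈map : 1 ∈ˡ map h (word d [ a ])
  1∈map = ∈-take⁻ (suc p) _ (subst (1 ∈ˡ_) (sym take≡w) (∈-++⁺ʳ (replicate p 0) (here refl)))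

-- A system of constant size for a^p b.

aᵖb-system : ℕ → LSystem
aᵖb-system p = record
  { σ      = 2
  ; symbol = mk↣ toℕ-injective
  ; φ      = λ { fzero → fzero ∷ [] ; (fsuc fzero) → fzero ∷ fsuc fzero ∷ [] }
  ; τ      = id
  ; s      = fsuc fzero ∷ []
  ; d      = p
  -- The iterated word has exactly this length, so truncation removes nothing.
  ; n      = suc p
  ; 1≤n    = s≤s z≤n
  }

aᵖb-system-generates : ∀ p → Generates (aᵖb-system p) (aᵖb p)
aᵖb-system-generates p = output≡ , length-aᵖb p
  where
  open LSystem (aᵖb-system p)
  open ≡-Reasoning

  φ*-step : ∀ q → φ* (replicate q fzero ++ [ fsuc fzero ])
                ≡ replicate (suc q) fzero ++ [ fsuc fzero ]
  φ*-step zero    = refl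
  φ*-step (suc q) = cong (fzero ∷_) (φ*-step q)

  φ*-power : ∀ q → iterate φ* q [ fsuc fzero ] ≡ replicate q fzero ++ [ fsuc fzero ]
  φ*-power zero    = refl
  φ*-power (suc q) = trans (cong φ* (φ*-power q)) (φ*-step q)

  output≡ : output ≡ aᵖb p
  output≡ = begin
    map toℕ (take (suc p) (map id φᵈ[s])) ≡⟨ take-map (suc p) (map id φᵈ[s]) ⟨
    take (suc p) (map toℕ (map id φᵈ[s])) ≡⟨ cong (take (suc p) ∘ map toℕ)
                                               (trans (map-id φᵈ[s]) (φ*-power p)) ⟩
    take (suc p) (map toℕ (replicate p fzero ++ [ fsuc fzero ]))
      ≡⟨ cong (take (suc p)) (trans (map-++ toℕ (replicate p fzero) _)
                                    (cong (_++ [ 1 ]) (map-replicate toℕ p fzero))) ⟩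
    take (suc p) (aᵖb p)                  ≡⟨ take-all (suc p) (aᵖb p) (≤-reflexive (length-aᵖb p)) ⟩
    aᵖb p                                 ∎

aᵖb-system-bounded : ∀ p k → 1 ≤ p → 1 ≤ k → PolyBounded k (aᵖb-system p)
aᵖb-system-bounded p k 1≤p 1≤k = ≤-trans (n≤1+n p) n≤n^k , ≤-trans (s≤s 1≤p) n≤n^k
  where
  n≤n^k : suc p ≤ suc p ^ k
  n≤n^k = ≤-trans (≤-reflexive (sym (*-identityʳ (suc p)))) (^-monoʳ-≤ (suc p) 1≤k)

-- From powers to logarithms.

n<2^[1+⌊log₂n⌋] : ∀ n → n < 2 ^ suc ⌊log₂ n ⌋
n<2^[1+⌊log₂n⌋] n = ≰⇒> λ 2^≤n →
  1+n≰n (subst (_≤ ⌊log₂ n ⌋) (⌊log₂[2^n]⌋≡n (suc ⌊log₂ n ⌋)) (⌊log₂⌋-mono-≤ 2^≤n))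

-- If `m` is at least log n, the bound follows from log log n being at least 1. Otherwise log m is
-- at most about log log n, and taking logarithms of `n ≤ m ^ m` suffices; the factor 2 absorbs the
-- rounding, as `1 + ll ≤ 2 * ll`.
n≤m^m⇒log-bound : ∀ {m n} → 4 ≤ n → n ≤ m ^ m →
                  ⌊log₂ n ⌋ ≤ 2 * (m * ⌊log₂ ⌊log₂ n ⌋ ⌋)
n≤m^m⇒log-bound {m} {n} 4≤n n≤m^m = [ large , small ]′ (≤-total l m)
  where
  open ≤-Reasoning
  l  = ⌊log₂ n ⌋
  ll = ⌊log₂ l ⌋

  -- The threshold 4 is the least `n` whose iterated logarithm reaches 1.
  1≤ll : 1 ≤ ll
  1≤ll = ⌊log₂⌋-mono-≤ {2} (⌊log₂⌋-mono-≤ {4} 4≤n)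

  rearrange : ∀ a b → (a + a) * b ≡ 2 * (b * a)
  rearrange = solve-∀

  large : l ≤ m → l ≤ 2 * (m * ll)
  large l≤m = begin
    l             ≤⟨ l≤m ⟩
    m             ≡⟨ *-identityʳ m ⟨
    m * 1         ≤⟨ *-monoʳ-≤ m 1≤ll ⟩
    m * ll        ≤⟨ m≤m+n (m * ll) _ ⟩
    2 * (m * ll)  ∎

  small : m ≤ l → l ≤ 2 * (m * ll)
  small m≤l = begin
    l                           ≤⟨ ⌊log₂⌋-mono-≤ n≤m^m ⟩
    ⌊log₂ m ^ m ⌋               ≤⟨ ⌊log₂⌋-mono-≤ (^-monoˡ-≤ m m≤2^) ⟩
    ⌊log₂ (2 ^ suc ll) ^ m ⌋    ≡⟨ cong ⌊log₂_⌋ (^-*-assoc 2 (suc ll) m) ⟩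
    ⌊log₂ 2 ^ (suc ll * m) ⌋    ≡⟨ ⌊log₂[2^n]⌋≡n (suc ll * m) ⟩
    suc ll * m                  ≤⟨ *-monoˡ-≤ m (+-monoˡ-≤ ll 1≤ll) ⟩
    (ll + ll) * m               ≡⟨ rearrange ll m ⟩
    2 * (m * ll)                ∎
    where
    m≤2^ : m ≤ 2 ^ suc ll
    m≤2^ = ≤-trans m≤l (<⇒≤ (n<2^[1+⌊log₂n⌋] l))

lemma6 : Σ[ F ∈ Pred String 0ℓ ]
    (IsStringFamily F ×
    (∀ (k : ℕ) → 1 ≤ k →
    ∃[ c ] ∃[ n₀ ]
    (∀ w → w ∈ F → n₀ ≤ length w →
    ∀ ℓ ℓₘ → Isℓ k w ℓ → Isℓₘ k w ℓₘ →
    ℓ * ⌊log₂ (length w) ⌋ ≤ c * (ℓₘ * ⌊log₂ ⌊log₂ (length w) ⌋ ⌋))))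
-- The constant 16 is the size 8 of `aᵖb-system` times the factor 2 of the logarithmic bound.
lemma6 = (λ w → ∃[ p ] w ≡ aᵖb p) , unbounded , λ k 1≤k → 16 , 4 , bound k 1≤k
  where
  unbounded : IsStringFamily (λ w → ∃[ p ] w ≡ aᵖb p)
  unbounded m = aᵖb m , (m , refl) , ≤-trans (n≤1+n m) (≤-reflexive (sym (length-aᵖb m)))

  bound : ∀ k → 1 ≤ k → ∀ w → ∃[ p ] w ≡ aᵖb p → 4 ≤ length w →
          ∀ ℓ ℓₘ → Isℓ k w ℓ → Isℓₘ k w ℓₘ →
          ℓ * ⌊log₂ (length w) ⌋ ≤ 16 * (ℓₘ * ⌊log₂ ⌊log₂ (length w) ⌋ ⌋)
  bound k 1≤k _ (p , refl) 4≤n ℓ _ (_ , ℓ-least) ((L , prol , _ , gen , refl) , _) = begin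
    ℓ * l               ≤⟨ *-monoˡ-≤ l ℓ≤8 ⟩
    8 * l               ≤⟨ *-monoʳ-≤ 8 (n≤m^m⇒log-bound {m} 4≤n n≤m^m) ⟩
    8 * (2 * (m * ll))  ≡⟨ *-assoc 8 2 (m * ll) ⟨
    16 * (m * ll)       ∎
    where
    open ≤-Reasoning
    m  = LSystem.size L
    l  = ⌊log₂ (length (aᵖb p)) ⌋
    ll = ⌊log₂ l ⌋

    1≤p : 1 ≤ p
    1≤p with s≤s 3≤p ← subst (4 ≤_) (length-aᵖb p) 4≤n = ≤-trans (s≤s z≤n) 3≤p

    -- Rules of total length 1 + 2, an axiom of length 1, two letters, and the additive 2 make 8.
    ℓ≤8 : ℓ ≤ 8
    ℓ≤8 = ℓ-least 8 (aᵖb-system p , aᵖb-system-bounded p k 1≤p 1≤k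
                    , aᵖb-system-generates p , refl)

    n≤m^m : length (aᵖb p) ≤ m ^ m
    n≤m^m = ≤-trans (≤-reflexive (length-aᵖb p)) (prolongable-lower-bound p L prol gen)
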